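{- Let $\mathcal{T}_1$ and $\mathcal{T}_2$ be normalised $\mathcal{ELH}^r$-terminologies and $\Sigma$ a signature. If $\varphi \in \mathsf{iDiff}_\Sigma(\mathcal{T}_1,\mathcal{T}_2)$, then at least one of the following conditions holds: 1. $(\{r(a,b)\}, s(a,b)) \in \mathsf{iDiff}_\Sigma(\mathcal{T}_1,\mathcal{T}_2)$ for some role names $r,s \in \mathsf{sig}(\varphi)$ (and individual names $a,b$); 2. $(\mathcal{A}, A(b)) \in \mathsf{iDiff}_\Sigma(\mathcal{T}_1,\mathcal{T}_2)$ for some concept name $A \in \mathsf{sig}(\varphi)$, individual name $b$, and ABox $\mathcal{A}$ with $\mathsf{sig}(\mathcal{A}) \subseteq \mathsf{sig}(\varphi)$; 3. $(\mathcal{A}, D(b)) \in \mathsf{iDiff}_\Sigma(\mathcal{T}_1,\mathcal{T}_2)$ for some singleton ABox $\mathcal{A}$, individual name $b$ in $\mathcal{A}$, and $\mathcal{EL}$-concept $D$ such that $\mathsf{sig}(\mathcal{A}), \mathsf{sig}(D) \subseteq \mathsf{sig}(\varphi)$.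
   Context: $\mathsf{N_C},\mathsf{N_R},\mathsf{N_I}$ are countably infinite, mutually disjoint sets of concept names, role names and individual names. $\mathcal{EL}$-concepts: $C ::= A \mid \top \mid C\sqcap D \mid \exists r.C$ with $A\in\mathsf{N_C}$, $r\in\mathsf{N_R}$. $\mathcal{ELH}^r$-inclusions are: concept inclusions $C\sqsubseteq D$, $\mathsf{ran}(r)\sqsubseteq D$, $\mathsf{ran}(r)\sqcap C\sqsubseteq D$; concept equations $C\equiv D$; role inclusions $r\sqsubseteq s$ (with $C,D$ $\mathcal{EL}$-concepts, $r,s\in\mathsf{N_R}$). An $\mathcal{ELH}^r$-TBox is a finite set of $\mathcal{ELH}^r$-inclusions. Semantics: an interpretation $\mathcal{I}=(\Delta^{\mathcal I},\cdot^{\mathcal I})$ has a nonempty domain, $A^{\mathcal I}\subseteq\Delta^{\mathcal I}$, $r^{\mathcal I}\subseteq\Delta^{\mathcal I}\times\Delta^{\mathcal I}$, $a^{\mathcal I}\in\Delta^{\mathcal I}$; $\top^{\mathcal I}=\Delta^{\mathcal I}$, $(C\sqcap D)^{\mathcal I}=C^{\mathcal I}\cap D^{\mathcal I}$, $(\exists r.C)^{\mathcal I}=\{d\mid\exists e\in C^{\mathcal I}:(d,e)\in r^{\mathcal I}\}$, $\mathsf{ran}(r)^{\mathcal I}=\{d\mid\exists e:(e,d)\in r^{\mathcal I}\}$. Inclusions (equations) are satisfied if the corresponding set inclusion (equality) holds; $\mathcal I\models C(a)$ iff $a^{\mathcal I}\in C^{\mathcal I}$; $\mathcal I\models r(a,b)$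 iff $(a^{\mathcal I},b^{\mathcal I})\in r^{\mathcal I}$. $\mathcal T\models\alpha$ means every model of $\mathcal T$ satisfies $\alpha$. An $\mathcal{ELH}^r$-terminology is an $\mathcal{ELH}^r$-TBox all of whose concept inclusions and equations have the form $A\sqsubseteq C$, $A\equiv C$, $\mathsf{ran}(r)\sqsubseteq C$ or $\exists r.\top\sqsubseteq C$, with $A\in\mathsf{N_C}$, $C$ an $\mathcal{EL}$-concept with $C\neq\top$, $C\ne\top\sqcap\top$, etc., and in which no concept name occurs more than once on the left-hand side. A concept name $A$ is pseudo-primitive in $\mathcal T$ if there is no $A\equiv C\in\mathcal T$; it is non-conjunctive in $\mathcal T$ if it is pseudo-primitive in $\mathcal T$ or there is an $A\equiv\exists r.C\in\mathcal T$. The terminology is normalised if, apart from role inclusions, it consists of inclusions of the forms: $A\equiv\exists r.B$ or $A\equiv F$ ($A,B$ concept names, $F$ a nonempty conjunction of concept names non-conjunctive in $\mathcal T$); $E\sqsubseteq\exists r.B$, $E\sqsubseteq\exists r.\top$ or $E\sqsubseteq F$ ($B$ a concept name, $E$ a concept name or $\exists s.\top$ or $\mathsf{ran}(s)$, $F$ as before). An ABox is a nonempty finite set of assertions $\top(a)$, $A(a)$, $r(a,b)$ ($A\in\mathsf{N_C}$, $r\in\mathsf{N_R}$, $a,b\in\mathsf{N_I}$); it is singleton if it has exactly one assertion. Instance assertions are $C(a)$ ($C$ an $\mathcal{EL}$-concept) and $r(a,b)$. $(\mathcal T,\mathcal A)\models\alpha$ for an instance assertion $\alpha$ means that every individual name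 in $\alpha$ occurs in $\mathcal A$ and every model of $\mathcal T$ and $\mathcal A$ satisfies $\alpha$. A signature is a subset $\Sigma\subseteq\mathsf{N_C}\cup\mathsf{N_R}$; $\mathsf{sig}(E)$ is the set of concept and role names occurring in $E$ (for a pair, in either component); $E$ is a $\Sigma$-object if $\mathsf{sig}(E)\subseteq\Sigma$. $\mathsf{iDiff}_\Sigma(\mathcal T_1,\mathcal T_2)$ is the set of pairs $(\mathcal A,\alpha)$ with $\mathcal A$ a $\Sigma$-ABox and $\alpha$ a $\Sigma$-instance assertion such that $(\mathcal T_1,\mathcal A)\models\alpha$ and $(\mathcal T_2,\mathcal A)\not\models\alpha$. -}

module Defs where

open import Level using (0ℓ; suc)
open import Data.List.Base using (List)
open import Data.List.Membership.Propositional using () renaming (_∈_ to _∈ᴸ_)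
open import Data.List.NonEmpty.Base using (List⁺; toList)
open import Data.List.Relation.Unary.All using (All)
open import Data.List.Relation.Unary.Any using (Any)
open import Data.Nat.Base using (ℕ)
open import Data.Product.Base using (_×_; _,_; ∃-syntax; ∃₂)
open import Data.Sum.Base using (_⊎_; inj₁; inj₂)
open import Relation.Binary.Core using (Rel; _⇒_)
open import Relation.Binary.PropositionalEquality.Core using (_≡_)
open import Relation.Nullary.Negation.Core using (¬_)
open import Relation.Unary using (Pred; _∈_; _⊆_; _∩_; _∪_; ∅; U; ｛_｝)
  renaming (_≐_ to _≐ᴾ_)

-- Three separate copies of ℕ: countably infinite and mutually disjoint.

record ConceptName : Set where
  constructor mkConceptName
  field index : ℕ

record RoleName : Set where
  constructor mkRoleName
  field index : ℕ

record IndividualName : Set where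
  constructor mkIndividualName
  field index : ℕ

infixr 7 _⊓_
infixr 8 ∃⟨_⟩_
infix  4 _⊑_ _≐_ _⊑ʳ_ ran⟨_⟩⊑_ ran⟨_⟩⊓_⊑_

data Concept : Set where
  name  : ConceptName → Concept
  ⊤     : Concept
  _⊓_   : Concept → Concept → Concept
  ∃⟨_⟩_ : RoleName → Concept → Concept

data Inclusion : Set where
  _⊑_        : Concept → Concept → Inclusion
  ran⟨_⟩⊑_   : RoleName → Concept → Inclusion
  ran⟨_⟩⊓_⊑_ : RoleName → Concept → Concept → Inclusion
  _≐_        : Concept → Concept → Inclusion
  _⊑ʳ_       : RoleName → RoleName → Inclusion

-- Lists stand for finite sets: every notion below depends on a TBox or an
-- ABox only through membership, never on order or multiplicity.

TBox : Set
TBox = List Inclusion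

data Assertion : Set where
  top  : IndividualName → Assertion
  name : ConceptName → IndividualName → Assertion
  role : RoleName → IndividualName → IndividualName → Assertion

ABox : Set
ABox = List⁺ Assertion

Singleton : Pred ABox 0ℓ
Singleton 𝒜 = ∃[ β ] All (_≡ β) (toList 𝒜)

data InstanceAssertion : Set where
  concept : Concept → IndividualName → InstanceAssertion
  role    : RoleName → IndividualName → IndividualName → InstanceAssertion

-- The domain is nonempty because it contains the values of `individual`.

record Interpretation : Set₁ where
  field
    Δ          : Set
    conceptⁱ   : ConceptName → Pred Δ 0ℓ
    roleⁱ      : RoleName → Rel Δ 0ℓ
    individual : IndividualName → Δ

  ⟦_⟧ : Concept → Pred Δ 0ℓ
  ⟦ name A ⟧     = conceptⁱ A
  ⟦ ⊤ ⟧          = U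
  ⟦ C ⊓ D ⟧      = ⟦ C ⟧ ∩ ⟦ D ⟧
  ⟦ ∃⟨ r ⟩ C ⟧ d = ∃[ e ] (e ∈ ⟦ C ⟧ × roleⁱ r d e)

  range : RoleName → Pred Δ 0ℓ
  range r d = ∃[ e ] roleⁱ r e d

  SatisfiesInclusion : Pred Inclusion 0ℓ
  SatisfiesInclusion (C ⊑ D)           = ⟦ C ⟧ ⊆ ⟦ D ⟧
  SatisfiesInclusion (ran⟨ r ⟩⊑ D)     = range r ⊆ ⟦ D ⟧
  SatisfiesInclusion (ran⟨ r ⟩⊓ C ⊑ D) = range r ∩ ⟦ C ⟧ ⊆ ⟦ D ⟧
  SatisfiesInclusion (C ≐ D)           = ⟦ C ⟧ ≐ᴾ ⟦ D ⟧
  SatisfiesInclusion (r ⊑ʳ s)          = roleⁱ r ⇒ roleⁱ s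

  SatisfiesInstance : Pred InstanceAssertion 0ℓ
  SatisfiesInstance (concept C a) = individual a ∈ ⟦ C ⟧
  SatisfiesInstance (role r a b)  = roleⁱ r (individual a) (individual b)

  SatisfiesAssertion : Pred Assertion 0ℓ
  SatisfiesAssertion (top a)      = SatisfiesInstance (concept ⊤ a)
  SatisfiesAssertion (name A a)   = SatisfiesInstance (concept (name A) a)
  SatisfiesAssertion (role r a b) = SatisfiesInstance (role r a b)

  IsModelᵀ : Pred TBox 0ℓ
  IsModelᵀ 𝒯 = All SatisfiesInclusion 𝒯

  IsModelᴬ : Pred ABox 0ℓ
  IsModelᴬ 𝒜 = All SatisfiesAssertion (toList 𝒜)

open Interpretation public
  using (SatisfiesInclusion; SatisfiesInstance; SatisfiesAssertion; IsModelᵀ; IsModelᴬ)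

-- The concepts ⊤, ⊤ ⊓ ⊤, (⊤ ⊓ ⊤) ⊓ ⊤, ...
data Trivial : Pred Concept 0ℓ where
  ⊤   : Trivial ⊤
  _⊓_ : ∀ {C D} → Trivial C → Trivial D → Trivial (C ⊓ D)

data TerminologyForm : Pred Inclusion 0ℓ where
  name⊑ : ∀ {A C} → ¬ Trivial C → TerminologyForm (name A ⊑ C)
  name≐ : ∀ {A C} → ¬ Trivial C → TerminologyForm (name A ≐ C)
  ran⊑  : ∀ {r C} → ¬ Trivial C → TerminologyForm (ran⟨ r ⟩⊑ C)
  ∃⊤⊑   : ∀ {r C} → ¬ Trivial C → TerminologyForm (∃⟨ r ⟩ ⊤ ⊑ C)
  role⊑ : ∀ {r s} → TerminologyForm (r ⊑ʳ s)

-- Inclusions of terminology form contain a concept name on the left-hand side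
-- only when that side is the name itself.
data HasLhs (A : ConceptName) : Pred Inclusion 0ℓ where
  name⊑ : ∀ {C} → HasLhs A (name A ⊑ C)
  name≐ : ∀ {C} → HasLhs A (name A ≐ C)

record IsTerminology (𝒯 : TBox) : Set where
  field
    form      : All TerminologyForm 𝒯
    uniqueLhs : ∀ {A ι κ} → ι ∈ᴸ 𝒯 → κ ∈ᴸ 𝒯 → HasLhs A ι → HasLhs A κ → ι ≡ κ

PseudoPrimitive : TBox → Pred ConceptName 0ℓ
PseudoPrimitive 𝒯 A = ¬ (∃[ C ] (name A ≐ C) ∈ᴸ 𝒯)

NonConjunctive : TBox → Pred ConceptName 0ℓ
NonConjunctive 𝒯 A = PseudoPrimitive 𝒯 A ⊎ (∃₂ λ r C → (name A ≐ ∃⟨ r ⟩ C) ∈ᴸ 𝒯)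

data ConjunctionOf (P : Pred ConceptName 0ℓ) : Pred Concept 0ℓ where
  name : ∀ {A} → P A → ConjunctionOf P (name A)
  _⊓_  : ∀ {C D} → ConjunctionOf P C → ConjunctionOf P D → ConjunctionOf P (C ⊓ D)

data NormalRhs (𝒯 : TBox) : Pred Concept 0ℓ where
  ∃name       : ∀ {r B} → NormalRhs 𝒯 (∃⟨ r ⟩ name B)
  ∃⊤          : ∀ {r} → NormalRhs 𝒯 (∃⟨ r ⟩ ⊤)
  conjunction : ∀ {F} → ConjunctionOf (NonConjunctive 𝒯) F → NormalRhs 𝒯 F

data NormalForm (𝒯 : TBox) : Pred Inclusion 0ℓ where
  name≐∃    : ∀ {A r B} → NormalForm 𝒯 (name A ≐ ∃⟨ r ⟩ name B)
  name≐conj : ∀ {A F} → ConjunctionOf (NonConjunctive 𝒯) F → NormalForm 𝒯 (name A ≐ F)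
  name⊑     : ∀ {A C} → NormalRhs 𝒯 C → NormalForm 𝒯 (name A ⊑ C)
  ∃⊤⊑       : ∀ {s C} → NormalRhs 𝒯 C → NormalForm 𝒯 (∃⟨ s ⟩ ⊤ ⊑ C)
  ran⊑      : ∀ {s C} → NormalRhs 𝒯 C → NormalForm 𝒯 (ran⟨ s ⟩⊑ C)
  role⊑     : ∀ {r s} → NormalForm 𝒯 (r ⊑ʳ s)

record IsNormalisedTerminology (𝒯 : TBox) : Set where
  field
    isTerminology : IsTerminology 𝒯
    normalised    : All (NormalForm 𝒯) 𝒯

indAssertion : Assertion → Pred IndividualName 0ℓ
indAssertion (top a)      = ｛ a ｝
indAssertion (name A a)   = ｛ a ｝
indAssertion (role r a b) = ｛ a ｝ ∪ ｛ b ｝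

indABox : ABox → Pred IndividualName 0ℓ
indABox 𝒜 a = Any (λ β → a ∈ indAssertion β) (toList 𝒜)

indInstance : InstanceAssertion → Pred IndividualName 0ℓ
indInstance (concept C a) = ｛ a ｝
indInstance (role r a b)  = ｛ a ｝ ∪ ｛ b ｝

Symbol : Set
Symbol = ConceptName ⊎ RoleName

Signature : Set₁
Signature = Pred Symbol 0ℓ

sigConcept : Concept → Signature
sigConcept (name A)   = ｛ inj₁ A ｝
sigConcept ⊤          = ∅
sigConcept (C ⊓ D)    = sigConcept C ∪ sigConcept D
sigConcept (∃⟨ r ⟩ C) = ｛ inj₂ r ｝ ∪ sigConcept C

sigAssertion : Assertion → Signature
sigAssertion (top a)      = ∅
sigAssertion (name A a)   = ｛ inj₁ A ｝
sigAssertion (role r a b) = ｛ inj₂ r ｝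

sigABox : ABox → Signature
sigABox 𝒜 X = Any (λ β → X ∈ sigAssertion β) (toList 𝒜)

sigInstance : InstanceAssertion → Signature
sigInstance (concept C a) = sigConcept C
sigInstance (role r a b)  = ｛ inj₂ r ｝

sig : ABox × InstanceAssertion → Signature
sig (𝒜 , α) = sigABox 𝒜 ∪ sigInstance α

infix 4 _⊨_

_⊨_ : TBox × ABox → InstanceAssertion → Set₁
(𝒯 , 𝒜) ⊨ α =
  indInstance α ⊆ indABox 𝒜 ×
  (∀ ℐ → IsModelᵀ ℐ 𝒯 → IsModelᴬ ℐ 𝒜 → SatisfiesInstance ℐ α)

iDiff : Signature → TBox → TBox → Pred (ABox × InstanceAssertion) (suc 0ℓ)
iDiff Σ 𝒯₁ 𝒯₂ (𝒜 , α) =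
  sigABox 𝒜 ⊆ Σ × sigInstance α ⊆ Σ × (𝒯₁ , 𝒜) ⊨ α × ¬ ((𝒯₂ , 𝒜) ⊨ α)

{-# OPTIONS --safe #-}

-- Over a finite set of elements, namely the individual names of the ABox and
-- one anonymous element per existential restriction of the TBox, the least
-- model of a normalised terminology and an ABox is a finite Horn closure.  It
-- is universal for instance assertions, so that instance checking is decidable,
-- which is what makes the case distinctions constructive.
--
-- The concept of the given instance assertion is taken apart inside the
-- canonical model of 𝒯₁.  Only ∃r.D at a named a with an anonymous r-successor
-- is not immediate.  As a concept name has at most one left-hand side
-- occurrence, a concept name deduced from several assertions at once is fully
-- defined, and unfolding its definition leads either to a single assertion
-- that already entails ∃r.D(a), or to a named individual to which the anonymous
-- successor can be mapped.
module Submission where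

open import Data.Empty using (⊥-elim)
open import Data.List.Base
  using (List; []; _∷_; _++_; concatMap; cartesianProduct)
import Data.List.Membership.DecPropositional as DecMembership
open import Data.List.Membership.Propositional using (lose) renaming (_∈_ to _∈ᴸ_)
open import Data.List.Membership.Propositional.Properties
  using (∈-++⁺ˡ; ∈-++⁺ʳ; ∈-concatMap⁺; ∈-cartesianProduct⁺; ∈-cartesianProduct⁻)
open import Data.List.NonEmpty.Base using ([_]; toList)
open import Data.List.Relation.Unary.All as All using (All; []; _∷_; all?)
open import Data.List.Relation.Unary.All.Properties using (++⁺; ++⁻; concat⁺; map⁺)
open import Data.List.Relation.Unary.Any as Any using (here; there; any?)
import Data.Nat.Properties as ℕ
open import Data.Product.Base using (_×_; _,_; proj₁; proj₂; ∃-syntax)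
open import Data.Sum.Base using (_⊎_; inj₁; inj₂; [_,_]′)
open import Data.Unit.Base using (tt)
open import Function.Base using (_∘_; case_of_)
open import Level using (Level; 0ℓ)
open import Relation.Binary.Core using (_⇒_)
open import Relation.Binary.Definitions using (DecidableEquality)
open import Relation.Binary.PropositionalEquality.Core using (_≡_; refl; cong; cong₂)
open import Relation.Nullary.Decidable using (Dec; yes; no; map′; _×-dec_)
open import Relation.Nullary.Negation.Core using (¬_; contradiction)
open import Relation.Unary using (Pred; _∈_; _⊆_)
open import Defs

private
  variable
    ℓ : Level
    F : Set
    r r′ s : RoleName
    a b : IndividualName
    A : ConceptName
    C C′ D : Concept
    ι : Inclusion
    ℐ : Interpretation

open Interpretation using (Δ; conceptⁱ; roleⁱ; individual; range; ⟦_⟧)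

-- Horn closure

HornClause : Set → Set
HornClause F = List F × List F

Closed : List (HornClause F) → Pred F ℓ → Set ℓ
Closed P S = All (λ c → All S (proj₁ c) → All S (proj₂ c)) P

module Closure (_≟_ : DecidableEquality F) where
  open DecMembership _≟_ using (_∈?_)

  -- A clause that has fired can be discarded: its head is kept in the closure.
  close : List (HornClause F) → List F → List F
  close []             K = K
  close ((ps , hs) ∷ P) K with all? (_∈? close P K) ps
  ... | yes _ = close P (hs ++ close P K)
  ... | no  _ = close P K

  close-⊇ : ∀ P K {x} → x ∈ᴸ K → x ∈ᴸ close P K
  close-⊇ []              K x∈ = x∈
  close-⊇ ((ps , hs) ∷ P) K x∈ with all? (_∈? close P K) ps
  ... | yes _ = close-⊇ P _ (∈-++⁺ʳ hs (close-⊇ P K x∈))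
  ... | no  _ = close-⊇ P K x∈

  -- A clause that does not fire is satisfied vacuously: its body is tested against the very list
  -- that is returned.
  close-closed : ∀ P K → Closed P (_∈ᴸ close P K)
  close-closed []              K = []
  close-closed ((ps , hs) ∷ P) K with all? (_∈? close P K) ps
  ... | yes _ = (λ _ → All.tabulate (close-⊇ P _ ∘ ∈-++⁺ˡ)) ∷ close-closed P _
  ... | no ¬p = (λ p → contradiction p ¬p) ∷ close-closed P K

  -- This is the induction principle for derived facts. The level of `S` is left open because
  -- `Origin` takes values in `Set₁`.
  close-least : ∀ P K {S : Pred F ℓ} → Closed P S → All S K → All S (close P K)
  close-least []              K _          k = k
  close-least ((ps , hs) ∷ P) K (c ∷ clos) k with all? (_∈? close P K) ps
  ... | yes p = close-least P _ clos
                  (++⁺ (c (All.map (All.lookup (close-least P K clos k)) p))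
                       (close-least P K clos k))
  ... | no  _ = close-least P K clos k

-- Facts of the canonical model

-- anon r C is the common witness of all restrictions ∃r.C.
data Element : Set where
  named : IndividualName → Element
  anon  : RoleName → Concept → Element

data Fact : Set where
  _at_ : ConceptName → Element → Fact
  edge : RoleName → Element → Element → Fact

_≟ᴬ_ : DecidableEquality ConceptName
mkConceptName i ≟ᴬ mkConceptName j = map′ (cong mkConceptName) (cong ConceptName.index) (i ℕ.≟ j)

_≟ᴿ_ : DecidableEquality RoleName
mkRoleName i ≟ᴿ mkRoleName j = map′ (cong mkRoleName) (cong RoleName.index) (i ℕ.≟ j)

_≟ᴵ_ : DecidableEquality IndividualName
mkIndividualName i ≟ᴵ mkIndividualName j =
  map′ (cong mkIndividualName) (cong IndividualName.index) (i ℕ.≟ j)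

_≟ᶜ_ : DecidableEquality Concept
name A     ≟ᶜ name B     = map′ (cong name) (λ { refl → refl }) (A ≟ᴬ B)
name _     ≟ᶜ ⊤          = no λ ()
name _     ≟ᶜ (_ ⊓ _)    = no λ ()
name _     ≟ᶜ (∃⟨ _ ⟩ _) = no λ ()
⊤          ≟ᶜ name _     = no λ ()
⊤          ≟ᶜ ⊤          = yes refl
⊤          ≟ᶜ (_ ⊓ _)    = no λ ()
⊤          ≟ᶜ (∃⟨ _ ⟩ _) = no λ ()
(_ ⊓ _)    ≟ᶜ name _     = no λ ()
(_ ⊓ _)    ≟ᶜ ⊤          = no λ ()
(C ⊓ D)    ≟ᶜ (C′ ⊓ D′)  =
  map′ (λ (p , q) → cong₂ _⊓_ p q) (λ { refl → refl , refl }) ((C ≟ᶜ C′) ×-dec (D ≟ᶜ D′))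
(_ ⊓ _)    ≟ᶜ (∃⟨ _ ⟩ _) = no λ ()
(∃⟨ _ ⟩ _) ≟ᶜ name _     = no λ ()
(∃⟨ _ ⟩ _) ≟ᶜ ⊤          = no λ ()
(∃⟨ _ ⟩ _) ≟ᶜ (_ ⊓ _)    = no λ ()
(∃⟨ r ⟩ C) ≟ᶜ (∃⟨ s ⟩ D) =
  map′ (λ (p , q) → cong₂ ∃⟨_⟩_ p q) (λ { refl → refl , refl }) ((r ≟ᴿ s) ×-dec (C ≟ᶜ D))

_≟ᴱ_ : DecidableEquality Element
named a  ≟ᴱ named b  = map′ (cong named) (λ { refl → refl }) (a ≟ᴵ b)
named _  ≟ᴱ anon _ _ = no λ ()
anon _ _ ≟ᴱ named _  = no λ ()
anon r C ≟ᴱ anon s D =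
  map′ (λ (p , q) → cong₂ anon p q) (λ { refl → refl , refl }) ((r ≟ᴿ s) ×-dec (C ≟ᶜ D))

_≟ᶠ_ : DecidableEquality Fact
(A at e)   ≟ᶠ (B at f) =
  map′ (λ (p , q) → cong₂ _at_ p q) (λ { refl → refl , refl }) ((A ≟ᴬ B) ×-dec (e ≟ᴱ f))
(_ at _)   ≟ᶠ edge _ _ _ = no λ ()
edge _ _ _ ≟ᶠ (_ at _)   = no λ ()
edge r e f ≟ᶠ edge s e′ f′ =
  map′ (λ { (refl , refl , refl) → refl }) (λ { refl → refl , refl , refl })
       ((r ≟ᴿ s) ×-dec (e ≟ᴱ e′) ×-dec (f ≟ᴱ f′))

private
  variable
    e f : Element

-- Grounding of inclusions

heads : Concept → Element → List Fact
heads (name A)   e = (A at e) ∷ []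
heads ⊤          e = []
heads (C ⊓ D)    e = heads C e ++ heads D e
heads (∃⟨ r ⟩ C) e = edge r e (anon r C) ∷ heads C (anon r C)

-- Facts that put e into C, with f as the only successor of e that is used.  They
-- are sufficient for every C, but necessary (for some f) only if C is Flat.
body : Concept → Element → Element → List Fact
body (name A)   e f = (A at e) ∷ []
body ⊤          e f = []
body (C ⊓ D)    e f = body C e f ++ body D e f
body (∃⟨ r ⟩ C) e f = edge r e f ∷ body C f f

-- These are the concepts that act as premises in a normalised terminology, definitions being read
-- in both directions. A bare `⊤` is left out: its elements need not be listed in `elements`.
data Flat (P : Pred ConceptName 0ℓ) : Pred Concept 0ℓ where
  name        : Flat P (name A)
  conjunction : ConjunctionOf P C → Flat P C
  ∃name       : Flat P (∃⟨ r ⟩ name A)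
  ∃⊤          : Flat P (∃⟨ r ⟩ ⊤)

-- Here `f` is a candidate successor of `e`, so range inclusions conclude at `f`. The clauses are
-- sound for every inclusion; normal form is what makes them complete.
ground : Inclusion → Element → Element → List (HornClause Fact)
ground (C ⊑ D)            e f = (body C e f , heads D e) ∷ []
ground (ran⟨ r ⟩⊑ D)      e f = (edge r e f ∷ [] , heads D f) ∷ []
ground (ran⟨ r ⟩⊓ C ⊑ D)  e f = (edge r e f ∷ body C f f , heads D f) ∷ []
ground (C ≐ D)            e f = (body C e f , heads D e) ∷ (body D e f , heads C e) ∷ []
ground (r ⊑ʳ s)           e f = (edge r e f ∷ [] , edge s e f ∷ []) ∷ []

witnesses : Concept → List Element
witnesses (name A)   = []
witnesses ⊤          = []
witnesses (C ⊓ D)    = witnesses C ++ witnesses D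
witnesses (∃⟨ r ⟩ C) = anon r C ∷ witnesses C

inclusionWitnesses : Inclusion → List Element
inclusionWitnesses (C ⊑ D)           = witnesses D
inclusionWitnesses (ran⟨ r ⟩⊑ D)     = witnesses D
inclusionWitnesses (ran⟨ r ⟩⊓ C ⊑ D) = witnesses D
inclusionWitnesses (C ≐ D)           = witnesses C ++ witnesses D
inclusionWitnesses (r ⊑ʳ s)          = []

assertedFacts : Assertion → List Fact
assertedFacts (top a)      = []
assertedFacts (name A a)   = (A at named a) ∷ []
assertedFacts (role r a b) = edge r (named a) (named b) ∷ []

-- `⊤(a)` contributes no element: every premise in a normalised terminology needs a fact, and `⊤(a)`
-- supplies none.
assertedElements : Assertion → List Element
assertedElements (top a)      = []
assertedElements (name A a)   = named a ∷ []
assertedElements (role r a b) = named a ∷ named b ∷ []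

Over : List Element → Pred Fact 0ℓ
Over E (A at e)     = e ∈ᴸ E
Over E (edge r e f) = e ∈ᴸ E × f ∈ᴸ E

heads-over : ∀ {E} C → e ∈ᴸ E → (∀ {x} → x ∈ᴸ witnesses C → x ∈ᴸ E) → All (Over E) (heads C e)
heads-over (name A)   e∈ w = e∈ ∷ []
heads-over ⊤          e∈ w = []
heads-over (C ⊓ D)    e∈ w =
  ++⁺ (heads-over C e∈ (w ∘ ∈-++⁺ˡ)) (heads-over D e∈ (w ∘ ∈-++⁺ʳ (witnesses C)))
heads-over (∃⟨ r ⟩ C) e∈ w =
  (e∈ , w (here refl)) ∷ heads-over C (w (here refl)) (w ∘ there)

ground-over : ∀ {E} ι → (∀ {x} → x ∈ᴸ inclusionWitnesses ι → x ∈ᴸ E) → e ∈ᴸ E → f ∈ᴸ E →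
              ∀ {ps hs} → (ps , hs) ∈ᴸ ground ι e f → All (Over E) hs
ground-over (C ⊑ D)           w e∈ f∈ (here refl)         = heads-over D e∈ w
ground-over (ran⟨ r ⟩⊑ D)     w e∈ f∈ (here refl)         = heads-over D f∈ w
ground-over (ran⟨ r ⟩⊓ C ⊑ D) w e∈ f∈ (here refl)         = heads-over D f∈ w
ground-over (C ≐ D)           w e∈ f∈ (here refl)         =
  heads-over D e∈ (w ∘ ∈-++⁺ʳ (witnesses C))
ground-over (C ≐ D)           w e∈ f∈ (there (here refl)) = heads-over C e∈ (w ∘ ∈-++⁺ˡ)
ground-over (r ⊑ʳ s)          w e∈ f∈ (here refl)         = (e∈ , f∈) ∷ []

Entails : TBox → ABox → InstanceAssertion → Set₁
Entails 𝒯 𝒜 α = ∀ ℐ → IsModelᵀ ℐ 𝒯 → IsModelᴬ ℐ 𝒜 → SatisfiesInstance ℐ α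

-- The canonical model

module Canonical (𝒯 : TBox) (𝒜 : ABox) where
  open Closure _≟ᶠ_

  elements : List Element
  elements = concatMap assertedElements (toList 𝒜) ++ concatMap inclusionWitnesses 𝒯

  program : List (HornClause Fact)
  program =
    concatMap (λ ι → concatMap (λ (e , f) → ground ι e f) (cartesianProduct elements elements)) 𝒯

  derived : List Fact
  derived = close program (concatMap assertedFacts (toList 𝒜))

  Derived : Pred Fact 0ℓ
  Derived = _∈ᴸ derived

  canonical : Interpretation
  canonical = record
    { Δ          = Element
    ; conceptⁱ   = λ A e → Derived (A at e)
    ; roleⁱ      = λ r e f → Derived (edge r e f)
    ; individual = named
    }

  derived-least : {S : Pred Fact ℓ} →
    (∀ {β} → β ∈ᴸ toList 𝒜 → All S (assertedFacts β)) →
    (∀ {ι e f ps hs} → ι ∈ᴸ 𝒯 → e ∈ᴸ elements → f ∈ᴸ elements →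
       (ps , hs) ∈ᴸ ground ι e f → All S ps → All S hs) →
    All S derived
  derived-least asserted fired =
    close-least program _
      (concat⁺ (map⁺ (All.tabulate λ ι∈ → concat⁺ (map⁺ (All.tabulate λ ef∈ →
        let e∈ , f∈ = ∈-cartesianProduct⁻ elements elements ef∈
        in All.tabulate (fired ι∈ e∈ f∈))))))
      (concat⁺ (map⁺ (All.tabulate asserted)))

  fire : ι ∈ᴸ 𝒯 → e ∈ᴸ elements → f ∈ᴸ elements →
         ∀ {ps hs} → (ps , hs) ∈ᴸ ground ι e f → All Derived ps → All Derived hs
  fire ι∈ e∈ f∈ c∈ = All.lookup (close-closed program _)
    (∈-concatMap⁺ _ (lose ι∈ (∈-concatMap⁺ _ (lose (∈-cartesianProduct⁺ e∈ f∈) c∈))))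

  derived-asserted : ∀ {β} → β ∈ᴸ toList 𝒜 → All Derived (assertedFacts β)
  derived-asserted β∈ = All.tabulate λ x∈ → close-⊇ program _ (∈-concatMap⁺ _ (lose β∈ x∈))

  -- The domain of `canonical` is all of `Element`, but clauses are instantiated over `elements`
  -- only. This closes the gap, and it also bounds the search for successors in `_∈⟦_⟧?`.
  derived-over : All (Over elements) derived
  derived-over = derived-least asserted λ {ι} ι∈ e∈ f∈ c∈ _ →
    ground-over ι (∈-++⁺ʳ (concatMap assertedElements (toList 𝒜)) ∘ ∈-concatMap⁺ _ ∘ lose ι∈)
                e∈ f∈ c∈
    where
    asserted-element : ∀ {β x} → β ∈ᴸ toList 𝒜 → x ∈ᴸ assertedElements β → x ∈ᴸ elements
    asserted-element β∈ x∈ = ∈-++⁺ˡ (∈-concatMap⁺ assertedElements (lose β∈ x∈))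

    asserted : ∀ {β} → β ∈ᴸ toList 𝒜 → All (Over elements) (assertedFacts β)
    asserted {top a}      β∈ = []
    asserted {name A a}   β∈ = asserted-element β∈ (here refl) ∷ []
    asserted {role r a b} β∈ =
      (asserted-element β∈ (here refl) , asserted-element β∈ (there (here refl))) ∷ []

  canonical-modelᴬ : IsModelᴬ canonical 𝒜
  canonical-modelᴬ = All.tabulate (λ {β} → satisfied β)
    where
    satisfied : ∀ β → β ∈ᴸ toList 𝒜 → SatisfiesAssertion canonical β
    satisfied (top a)      β∈ = tt
    satisfied (name A a)   β∈ = All.head (derived-asserted β∈)
    satisfied (role r a b) β∈ = All.head (derived-asserted β∈)

  heads⇒⟦⟧ : ∀ C → All Derived (heads C e) → e ∈ ⟦ canonical ⟧ C
  heads⇒⟦⟧ (name A)   (p ∷ _)  = p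
  heads⇒⟦⟧ ⊤          _        = tt
  heads⇒⟦⟧ (C ⊓ D)    ps       =
    let p , q = ++⁻ (heads C _) ps in heads⇒⟦⟧ C p , heads⇒⟦⟧ D q
  heads⇒⟦⟧ (∃⟨ r ⟩ C) (p ∷ ps) = anon r C , heads⇒⟦⟧ C ps , p

  conjunction-body : ∀ {P} → ConjunctionOf P C → e ∈ ⟦ canonical ⟧ C →
                     e ∈ᴸ elements × (∀ f → All Derived (body C e f))
  conjunction-body (name _) p       = All.lookup derived-over p , λ _ → p ∷ []
  conjunction-body (F ⊓ G)  (p , q) =
    let e∈ , ps = conjunction-body F p
        _  , qs = conjunction-body G q
    in e∈ , λ f → ++⁺ (ps f) (qs f)

  flat-body : ∀ {P} → Flat P C → e ∈ ⟦ canonical ⟧ C →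
              e ∈ᴸ elements × ∃[ f ] (f ∈ᴸ elements × All Derived (body C e f))
  flat-body name p =
    -- No successor is used, so `e` itself fills the slot of `f`.
    let e∈ = All.lookup derived-over p in e∈ , _ , e∈ , p ∷ []
  flat-body (conjunction F) p =
    let e∈ , ps = conjunction-body F p in e∈ , _ , e∈ , ps _
  flat-body ∃name (f , q , p) =
    let e∈ , f∈ = All.lookup derived-over p in e∈ , f , f∈ , p ∷ q ∷ []
  flat-body ∃⊤ (f , _ , p) =
    let e∈ , f∈ = All.lookup derived-over p in e∈ , f , f∈ , p ∷ []

  module _ (normal : All (NormalForm 𝒯) 𝒯) where

    fire-flat : ∀ D → ι ∈ᴸ 𝒯 → Flat (NonConjunctive 𝒯) C →
                (∀ {e f} → (body C e f , heads D e) ∈ᴸ ground ι e f) →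
                ⟦ canonical ⟧ C ⊆ ⟦ canonical ⟧ D
    fire-flat D ι∈ flat c∈ p =
      let e∈ , f , f∈ , ps = flat-body flat p in heads⇒⟦⟧ D (fire ι∈ e∈ f∈ c∈ ps)

    canonical-modelᵀ : IsModelᵀ canonical 𝒯
    canonical-modelᵀ = All.tabulate λ ι∈ → satisfied (All.lookup normal ι∈) ι∈
      where
      satisfied : NormalForm 𝒯 ι → ι ∈ᴸ 𝒯 → SatisfiesInclusion canonical ι
      satisfied (name≐∃ {A} {r} {B}) ι∈ =
        fire-flat (∃⟨ r ⟩ name B) ι∈ name (here refl) ,
        fire-flat (name A) ι∈ ∃name (there (here refl))
      satisfied (name≐conj {A} {F} conj) ι∈ =
        fire-flat F ι∈ name (here refl) ,
        fire-flat (name A) ι∈ (conjunction conj) (there (here refl))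
      satisfied (name⊑ {C = C} _) ι∈ = fire-flat C ι∈ name (here refl)
      satisfied (∃⊤⊑ {C = C} _)   ι∈ = fire-flat C ι∈ ∃⊤ (here refl)
      satisfied (ran⊑ {C = C} _)  ι∈ (e , p) =
        let e∈ , f∈ = All.lookup derived-over p in heads⇒⟦⟧ C (fire ι∈ e∈ f∈ (here refl) (p ∷ []))
      satisfied role⊑     ι∈ p =
        let e∈ , f∈ = All.lookup derived-over p in All.head (fire ι∈ e∈ f∈ (here refl) (p ∷ []))

  -- Soundness

  -- The ABox is assumed at named elements only. Facts at anonymous elements therefore hold in all
  -- models of the TBox, which later allows entailments from a single assertion.
  Simulated : (ℐ : Interpretation) → Element → Pred (Δ ℐ) 0ℓ
  Simulated ℐ (named a)  d = IsModelᴬ ℐ 𝒜 × individual ℐ a ≡ d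
  Simulated ℐ (anon r C) d = d ∈ ⟦ ℐ ⟧ C × d ∈ range ℐ r

  -- The range condition on an edge is what makes ran⟨ r ⟩ on a left-hand side sound:
  -- elements simulating f need not be successors of elements simulating e.
  Holds : Interpretation → Pred Fact 0ℓ
  Holds ℐ (A at e)     = Simulated ℐ e ⊆ conceptⁱ ℐ A
  Holds ℐ (edge r e f) =
    (∀ {d} → Simulated ℐ e d → ∃[ d′ ] (Simulated ℐ f d′ × roleⁱ ℐ r d d′)) ×
    Simulated ℐ f ⊆ range ℐ r

  heads-hold : ∀ C → Simulated ℐ e ⊆ ⟦ ℐ ⟧ C → All (Holds ℐ) (heads C e)
  heads-hold (name A)   p = p ∷ []
  heads-hold ⊤          p = []
  heads-hold (C ⊓ D)    p = ++⁺ (heads-hold C (proj₁ ∘ p)) (heads-hold D (proj₂ ∘ p))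
  heads-hold (∃⟨ r ⟩ C) p =
    ((λ {d} sim → let d′ , c , q = p sim in d′ , (c , d , q) , q) , proj₂) ∷ heads-hold C proj₁

  body-holds : ∀ C → All (Holds ℐ) (body C e f) → Simulated ℐ e ⊆ ⟦ ℐ ⟧ C
  body-holds (name A)   (p ∷ _)  sim = p sim
  body-holds ⊤          _        sim = tt
  body-holds (C ⊓ D)    ps       sim =
    let p , q = ++⁻ (body C _ _) ps in body-holds C p sim , body-holds D q sim
  body-holds (∃⟨ r ⟩ C) (p ∷ ps) sim =
    let d′ , sim′ , q = proj₁ p sim in d′ , body-holds C ps sim′ , q

  ground-sound : ∀ ι → SatisfiesInclusion ℐ ι → ∀ {ps hs} → (ps , hs) ∈ᴸ ground ι e f →
                 All (Holds ℐ) ps → All (Holds ℐ) hs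
  ground-sound (C ⊑ D)           m (here refl) ps       = heads-hold D (m ∘ body-holds C ps)
  ground-sound (ran⟨ r ⟩⊑ D)     m (here refl) (p ∷ _)  = heads-hold D (m ∘ proj₂ p)
  ground-sound (ran⟨ r ⟩⊓ C ⊑ D) m (here refl) (p ∷ ps) =
    heads-hold D (λ sim → m (proj₂ p sim , body-holds C ps sim))
  ground-sound (C ≐ D)           m (here refl) ps       = heads-hold D (proj₁ m ∘ body-holds C ps)
  ground-sound (C ≐ D)           m (there (here refl)) ps = heads-hold C (proj₂ m ∘ body-holds D ps)
  ground-sound (r ⊑ʳ s)          m (here refl) (p ∷ _)  =
    ((λ sim → let d′ , sim′ , q = proj₁ p sim in d′ , sim′ , m q) ,
     (λ sim → let d , q = proj₂ p sim in d , m q)) ∷ []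

  derived-sound : IsModelᵀ ℐ 𝒯 → All (Holds ℐ) derived
  derived-sound {ℐ} model =
    derived-least asserted λ {ι} ι∈ _ _ → ground-sound ι (All.lookup model ι∈)
    where
    asserted : ∀ {β} → β ∈ᴸ toList 𝒜 → All (Holds ℐ) (assertedFacts β)
    asserted {top a}      β∈ = []
    asserted {name A a}   β∈ = (λ { (m , refl) → All.lookup m β∈ }) ∷ []
    asserted {role r a b} β∈ =
      ((λ { (m , refl) → individual ℐ b , (m , refl) , All.lookup m β∈ }) ,
       (λ { (m , refl) → individual ℐ a , All.lookup m β∈ })) ∷ []

  -- By recursion on the concept: soundness of a derived edge supplies a successor that again
  -- simulates.
  simulation : IsModelᵀ ℐ 𝒯 → ∀ C → e ∈ ⟦ canonical ⟧ C → Simulated ℐ e ⊆ ⟦ ℐ ⟧ C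
  simulation m (name A)   p           sim = All.lookup (derived-sound m) p sim
  simulation m ⊤          _           sim = tt
  simulation m (C ⊓ D)    (p , q)     sim = simulation m C p sim , simulation m D q sim
  simulation m (∃⟨ r ⟩ C) (f , p , q) sim =
    let d′ , sim′ , q′ = proj₁ (All.lookup (derived-sound m) q) sim
    in d′ , simulation m C p sim′ , q′

  universal : ∀ α → SatisfiesInstance canonical α → Entails 𝒯 𝒜 α
  universal (concept C a) p ℐ mᵀ mᴬ = simulation mᵀ C p (mᴬ , refl)
  -- Only the value of `b` simulates `named b`, so the successor found is the right one.
  universal (role r a b)  p ℐ mᵀ mᴬ with proj₁ (All.lookup (derived-sound mᵀ) p) (mᴬ , refl)
  ... | _ , (_ , refl) , q = q

  -- Decidability of instance checking

  open DecMembership _≟ᶠ_ using (_∈?_)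

  _∈⟦_⟧? : ∀ e C → Dec (e ∈ ⟦ canonical ⟧ C)
  e ∈⟦ name A ⟧?   = (A at e) ∈? derived
  e ∈⟦ ⊤ ⟧?        = yes tt
  e ∈⟦ C ⊓ D ⟧?    = (e ∈⟦ C ⟧?) ×-dec (e ∈⟦ D ⟧?)
  e ∈⟦ ∃⟨ r ⟩ C ⟧? =
    map′ Any.satisfied
         (λ (f , p , q) → lose (proj₂ (All.lookup derived-over q)) (p , q))
         (any? (λ f → (f ∈⟦ C ⟧?) ×-dec (edge r e f ∈? derived)) elements)

  satisfies? : ∀ α → Dec (SatisfiesInstance canonical α)
  satisfies? (concept C a) = named a ∈⟦ C ⟧?
  satisfies? (role r a b)  = edge r (named a) (named b) ∈? derived

  entails? : All (NormalForm 𝒯) 𝒯 → ∀ α → Dec (Entails 𝒯 𝒜 α)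
  entails? normal α =
    map′ (universal α) (λ p → p canonical (canonical-modelᵀ normal) canonical-modelᴬ) (satisfies? α)

-- Origins of the facts about named individuals

module Origins (𝒯 : TBox) (𝒜 : ABox) (nt : IsNormalisedTerminology 𝒯) where
  open Canonical 𝒯 𝒜
  open IsNormalisedTerminology nt
  open IsTerminology isTerminology

  -- `P` ranges over arbitrary properties because the one used in `lone-edge` mentions the range of
  -- a role and is no concept.
  record Lone (a : IndividualName) (P : ∀ ℐ → Pred (Δ ℐ) 0ℓ) : Set₁ where
    constructor from
    field
      {β}     : Assertion
      β∈      : β ∈ᴸ toList 𝒜
      a∈      : a ∈ indAssertion β
      entails : ∀ ℐ → IsModelᵀ ℐ 𝒯 → SatisfiesAssertion ℐ β → P ℐ (individual ℐ a)

  -- Heads create edges to anonymous elements only, so an edge between named individuals comes from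
  -- one assertion through role inclusions.
  AssertedEdge : RoleName → IndividualName → IndividualName → Set₁
  AssertedEdge s a b =
    ∃[ r ] (role r a b ∈ᴸ toList 𝒜 × (∀ ℐ → IsModelᵀ ℐ 𝒯 → roleⁱ ℐ r ⇒ roleⁱ ℐ s))

  -- Where the facts about a named individual come from: a single assertion, the
  -- definition of the concept name, or, for an edge to an anonymous element, a
  -- named successor that already serves as the witness.
  data Origin : Fact → Set₁ where
    lone       : Lone a (λ ℐ → conceptⁱ ℐ A) → Origin (A at named a)
    defined    : (name A ≐ C) ∈ᴸ 𝒯 → All Derived (body C (named a) f) →
                 All Origin (body C (named a) f) → Origin (A at named a)
    asserted   : AssertedEdge s a b → Origin (edge s (named a) (named b))
    lone-edge  : Lone a (λ ℐ d → ∃[ d′ ] (Simulated ℐ (anon r C) d′ × roleⁱ ℐ s d d′)) →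
                 Origin (edge s (named a) (anon r C))
    named-edge : AssertedEdge s a b → Simulated canonical (anon r C) (named b) →
                 Origin (edge s (named a) (anon r C))
    anon-at    : Origin (A at anon r C)
    anon-edge  : Origin (edge s (anon r C) (anon r′ C′))

  canonical-model : IsModelᵀ canonical 𝒯
  canonical-model = canonical-modelᵀ normalised

  asserted⇒derived : AssertedEdge s a b → Derived (edge s (named a) (named b))
  asserted⇒derived (r , r∈ , r⊑s) =
    r⊑s canonical canonical-model (All.head (derived-asserted r∈))

  lone-map : ∀ {P Q : ∀ ℐ → Pred (Δ ℐ) 0ℓ} → (∀ ℐ → IsModelᵀ ℐ 𝒯 → P ℐ ⊆ Q ℐ) →
             Lone a P → Lone a Q
  lone-map P⊆Q (from β∈ a∈ p) = from β∈ a∈ λ ℐ m mβ → P⊆Q ℐ m (p ℐ m mβ)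

  heads-anon : ∀ C → All Origin (heads C (anon s D))
  heads-anon (name A)   = anon-at ∷ []
  heads-anon ⊤          = []
  heads-anon (C ⊓ D)    = ++⁺ (heads-anon C) (heads-anon D)
  heads-anon (∃⟨ r ⟩ C) = anon-edge ∷ heads-anon C

  heads-lone : ∀ C → Lone a (λ ℐ → ⟦ ℐ ⟧ C) → All Origin (heads C (named a))
  heads-lone (name A)   l = lone l ∷ []
  heads-lone ⊤          l = []
  heads-lone (C ⊓ D)    l =
    ++⁺ (heads-lone C (lone-map (λ _ _ → proj₁) l)) (heads-lone D (lone-map (λ _ _ → proj₂) l))
  heads-lone (∃⟨ r ⟩ C) l =
    lone-edge (lone-map (λ ℐ _ {d} (d′ , c , q) → d′ , (c , d , q) , q) l) ∷ heads-anon C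

  heads-conjunction : ∀ {P} → ConjunctionOf P C → All Origin (body C e f) → All Origin (heads C e)
  heads-conjunction (name _) o = o
  heads-conjunction {C ⊓ D} (F ⊓ G) os =
    let o , o′ = ++⁻ (body C _ _) os in ++⁺ (heads-conjunction F o) (heads-conjunction G o′)

  -- Any edge leaving `a` goes back to one assertion, so a premise `∃⟨ s ⟩ ⊤` yields only facts due
  -- to a single assertion.
  edge-source : Origin (edge s (named a) f) → Lone a (λ ℐ → ⟦ ℐ ⟧ (∃⟨ s ⟩ ⊤))
  edge-source (asserted (r , r∈ , r⊑s)) =
    from r∈ (inj₁ refl) λ ℐ m q → _ , tt , r⊑s ℐ m q
  edge-source (lone-edge l) = lone-map (λ ℐ _ (d′ , _ , q) → d′ , tt , q) l
  edge-source (named-edge o _) = edge-source (asserted o)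

  -- No origin leads from an anonymous element to a named one, so the edge is asserted.
  edge-target : Origin (edge s e (named b)) → Lone b (λ ℐ → range ℐ s)
  edge-target (asserted (r , r∈ , r⊑s)) =
    from r∈ (inj₂ refl) λ ℐ m q → _ , r⊑s ℐ m q

  edge-⊑ : (∀ ℐ → IsModelᵀ ℐ 𝒯 → roleⁱ ℐ r ⇒ roleⁱ ℐ s) → Origin (edge r e f) → Origin (edge s e f)
  edge-⊑ r⊑s (asserted (r , r∈ , q)) = asserted (r , r∈ , λ ℐ m → r⊑s ℐ m ∘ q ℐ m)
  edge-⊑ r⊑s (lone-edge l)           =
    lone-edge (lone-map (λ ℐ m (d′ , sim , q) → d′ , sim , r⊑s ℐ m q) l)
  edge-⊑ r⊑s (named-edge (r , r∈ , q) sim) =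
    named-edge (r , r∈ , λ ℐ m → r⊑s ℐ m ∘ q ℐ m) sim
  edge-⊑ r⊑s anon-edge = anon-edge

  -- Unfolding a definition redirects the edge from `f` to the common witness. A named `f` serves as
  -- witness itself; an anonymous `f` passes `C` on to whatever simulates it, in every model for a
  -- lone edge and in the canonical model for a named successor.
  edge-witness : ∀ C → Origin (edge r (named a) f) → f ∈ ⟦ canonical ⟧ C →
                 Origin (edge r (named a) (anon r C))
  edge-witness C (asserted o) p = named-edge o (p , _ , asserted⇒derived o)
  edge-witness C (lone-edge l) p =
    lone-edge (lone-map (λ ℐ m {d} (d′ , sim , q) → d′ , (simulation m C p sim , d , q) , q) l)
  edge-witness C (named-edge o sim) p =
    named-edge o (simulation canonical-model C p sim , _ , asserted⇒derived o)

  heads-defined : NormalForm 𝒯 (name A ≐ C) → All Derived (body C (named a) f) →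
                  All Origin (body C (named a) f) → All Origin (heads C (named a))
  heads-defined name≐∃           (_ ∷ p ∷ []) (o ∷ _) = edge-witness _ o p ∷ heads-anon (name _)
  heads-defined (name≐conj conj) _            os      = heads-conjunction conj os

  -- Uniqueness of left-hand sides rules out that `A` also has a definition.
  heads-name⊑ : ∀ C → (name A ⊑ C) ∈ᴸ 𝒯 → Origin (A at e) → All Origin (heads C e)
  heads-name⊑ C ι∈ (lone l) = heads-lone C (lone-map (λ ℐ m → All.lookup m ι∈) l)
  heads-name⊑ C ι∈ (defined ≐∈ _ _) = case uniqueLhs ι∈ ≐∈ name⊑ name≐ of λ ()
  heads-name⊑ C ι∈ anon-at = heads-anon C

  -- By uniqueness, the definition being unfolded is the one by which `A` was deduced, so its body
  -- already accounts for the heads.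
  heads-name≐ : ∀ C → (name A ≐ C) ∈ᴸ 𝒯 → Origin (A at e) → All Origin (heads C e)
  heads-name≐ C ι∈ (lone l) = heads-lone C (lone-map (λ ℐ m → proj₁ (All.lookup m ι∈)) l)
  heads-name≐ C ι∈ (defined ≐∈ ps os) with refl ← uniqueLhs ι∈ ≐∈ name≐ name≐ =
    heads-defined (All.lookup normalised ι∈) ps os
  heads-name≐ C ι∈ anon-at = heads-anon C

  at-defined : (name A ≐ C) ∈ᴸ 𝒯 → All Derived (body C e f) → All Origin (body C e f) →
               Origin (A at e)
  at-defined {e = named _}  ι∈ ps os = defined ι∈ ps os
  at-defined {e = anon _ _} ι∈ _  _  = anon-at

  ground-origin : NormalForm 𝒯 ι → ι ∈ᴸ 𝒯 → ∀ {ps hs} → (ps , hs) ∈ᴸ ground ι e f →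
                  All Derived ps → All Origin ps → All Origin hs
  ground-origin (name≐∃ {r = r} {B}) ι∈ (here refl) _ (o ∷ _) = heads-name≐ (∃⟨ r ⟩ name B) ι∈ o
  ground-origin (name≐conj {F = F} _) ι∈ (here refl) _ (o ∷ _) = heads-name≐ F ι∈ o
  ground-origin name≐∃ ι∈ (there (here refl)) ps os = at-defined ι∈ ps os ∷ []
  ground-origin (name≐conj _) ι∈ (there (here refl)) ps os = at-defined ι∈ ps os ∷ []
  ground-origin (name⊑ {C = C} _) ι∈ (here refl) _ (o ∷ _) = heads-name⊑ C ι∈ o
  ground-origin {e = named _} (∃⊤⊑ {C = C} _) ι∈ (here refl) _ (o ∷ _) =
    heads-lone C (lone-map (λ ℐ m → All.lookup m ι∈) (edge-source o))
  ground-origin {e = anon _ _} (∃⊤⊑ {C = C} _) ι∈ (here refl) _ _ = heads-anon C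
  ground-origin {f = named _} (ran⊑ {C = C} _) ι∈ (here refl) _ (o ∷ _) =
    heads-lone C (lone-map (λ ℐ m → All.lookup m ι∈) (edge-target o))
  ground-origin {f = anon _ _} (ran⊑ {C = C} _) ι∈ (here refl) _ _ = heads-anon C
  ground-origin role⊑ ι∈ (here refl) _ (o ∷ _) = edge-⊑ (λ ℐ m → All.lookup m ι∈) o ∷ []

  origin : All Origin derived
  -- Derivability is carried along in the induction, since `defined` stores it and `edge-witness`
  -- evaluates it in the canonical model.
  origin = All.map proj₂ (derived-least
    (λ β∈ → All.zip (derived-asserted β∈ , asserted-origin β∈))
    (λ ι∈ e∈ f∈ c∈ ps → let ds , os = All.unzip ps in
       All.zip (fire ι∈ e∈ f∈ c∈ ds , ground-origin (All.lookup normalised ι∈) ι∈ c∈ ds os)))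
    where
    asserted-origin : ∀ {β} → β ∈ᴸ toList 𝒜 → All Origin (assertedFacts β)
    asserted-origin {top a}      β∈ = []
    asserted-origin {name A a}   β∈ = lone (from β∈ refl λ _ _ p → p) ∷ []
    asserted-origin {role r a b} β∈ = asserted (r , β∈ , λ _ _ p → p) ∷ []

-- Reduction of a difference

module Difference (𝒯₁ 𝒯₂ : TBox)
                  (nt₁ : IsNormalisedTerminology 𝒯₁) (nt₂ : IsNormalisedTerminology 𝒯₂)
                  (Σ : Signature) (𝒜 : ABox) (α : InstanceAssertion)
                  (sig⊆Σ : sig (𝒜 , α) ⊆ Σ) where
  open Canonical 𝒯₁ 𝒜
  open Origins 𝒯₁ 𝒜 nt₁

  φ : ABox × InstanceAssertion
  φ = 𝒜 , α

  RoleDifference ConceptNameDifference SingletonDifference Reduced : Set₁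
  RoleDifference =
    ∃[ r ] ∃[ s ] ∃[ a ] ∃[ b ]
      (inj₂ r ∈ sig φ × inj₂ s ∈ sig φ × ([ role r a b ] , role s a b) ∈ iDiff Σ 𝒯₁ 𝒯₂)
  ConceptNameDifference =
    ∃[ 𝒜 ] ∃[ A ] ∃[ b ]
      (inj₁ A ∈ sig φ × sigABox 𝒜 ⊆ sig φ × (𝒜 , concept (name A) b) ∈ iDiff Σ 𝒯₁ 𝒯₂)
  SingletonDifference =
    ∃[ 𝒜 ] ∃[ D ] ∃[ b ]
      (Singleton 𝒜 × b ∈ indABox 𝒜 × sigABox 𝒜 ⊆ sig φ × sigConcept D ⊆ sig φ ×
       (𝒜 , concept D b) ∈ iDiff Σ 𝒯₁ 𝒯₂)
  Reduced = RoleDifference ⊎ ConceptNameDifference ⊎ SingletonDifference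

  sig-assertion : ∀ {β} → β ∈ᴸ toList 𝒜 → sigABox [ β ] ⊆ sig φ
  sig-assertion β∈ (here X∈) = inj₁ (lose β∈ X∈)

  entails-weaken : ∀ γ {β} → β ∈ᴸ toList 𝒜 → Entails 𝒯₂ [ β ] γ → Entails 𝒯₂ 𝒜 γ
  entails-weaken _ β∈ p ℐ mᵀ mᴬ = p ℐ mᵀ (All.lookup mᴬ β∈ ∷ [])

  -- The edge stems from one assertion `r(a,b)`. Testing `𝒯₂` on it alone gives either a difference
  -- or, by monotonicity, the entailment from `𝒜`.
  role-difference : inj₂ s ∈ sig φ → AssertedEdge s a b →
                    RoleDifference ⊎ Entails 𝒯₂ 𝒜 (role s a b)
  role-difference {s} {a} {b} s∈ (r , r∈ , r⊑s)
    with Canonical.entails? 𝒯₂ [ role r a b ] (IsNormalisedTerminology.normalised nt₂) (role s a b)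
  ... | yes p = inj₂ (entails-weaken (role s a b) r∈ p)
  ... | no ¬p = inj₁ (r , s , a , b , sig-assertion r∈ (here refl) , s∈ ,
                      sig⊆Σ ∘ sig-assertion r∈ , (λ { refl → sig⊆Σ s∈ }) ,
                      -- Both role assertions have the same individual names, so `here` is the
                      -- required inclusion.
                      (here , λ ℐ m mᴬ → r⊑s ℐ m (All.head mᴬ)) , ¬p ∘ proj₂)

  -- Recursion on `C` with the individual varying: once `𝒯₂` entails `r(a,b)`, failure of `∃⟨ r ⟩ D`
  -- at `a` becomes failure of `D` at `b`.
  reduce : ∀ C → a ∈ indABox 𝒜 → sigConcept C ⊆ sig φ → named a ∈ ⟦ canonical ⟧ C →
           ¬ Entails 𝒯₂ 𝒜 (concept C a) → Reduced
  reduce {a} (name A) a∈ σ p ¬e = inj₂ (inj₁ (𝒜 , A , a , σ refl , inj₁ , sig⊆Σ ∘ inj₁ , sig⊆Σ ∘ σ ,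
    ((λ { refl → a∈ }) , universal (concept (name A) a) p) , ¬e ∘ proj₂))
  reduce ⊤ a∈ σ p ¬e = contradiction (λ _ _ _ → tt) ¬e
  reduce {a} (C ⊓ D) a∈ σ (p , q) ¬e
    -- Decidability for `𝒯₂` selects a conjunct that is not entailed.
    with Canonical.entails? 𝒯₂ 𝒜 (IsNormalisedTerminology.normalised nt₂) (concept C a)
  ... | no ¬c = reduce C a∈ (σ ∘ inj₁) p ¬c
  ... | yes c = reduce D a∈ (σ ∘ inj₂) q λ d → ¬e λ ℐ mᵀ mᴬ → c ℐ mᵀ mᴬ , d ℐ mᵀ mᴬ
  reduce {a} (∃⟨ r ⟩ D) a∈ σ (f , p , q) ¬e = successor p (All.lookup origin q)
    where
    named-successor : named b ∈ ⟦ canonical ⟧ D → AssertedEdge r a b → Reduced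
    named-successor {b} p o@(_ , r∈ , _) with role-difference (σ (inj₁ refl)) o
    ... | inj₁ diff = inj₁ diff
    ... | inj₂ r-ab = reduce D (lose r∈ (inj₂ refl)) (σ ∘ inj₂) p
                        λ d → ¬e λ ℐ mᵀ mᴬ → individual ℐ b , d ℐ mᵀ mᴬ , r-ab ℐ mᵀ mᴬ

    successor : f ∈ ⟦ canonical ⟧ D → Origin (edge r (named a) f) → Reduced
    successor p (asserted o) = named-successor p o
    -- The named successor simulates `f` within the canonical model, so it inherits `D`.
    successor p (named-edge o sim) =
      named-successor (simulation canonical-model D p sim) o
    -- From `β` alone, `𝒯₁` yields a successor simulating the anonymous `f`, and `D` passes to it
    -- without the rest of the ABox.
    successor p (lone-edge (from {β} β∈ a∈β l)) = inj₂ (inj₂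
      ([ β ] , ∃⟨ r ⟩ D , a , (β , refl ∷ []) , here a∈β , sig-assertion β∈ , σ ,
       sig⊆Σ ∘ sig-assertion β∈ , sig⊆Σ ∘ σ ,
       ((λ { refl → here a∈β }) ,
        (λ ℐ m mᴬ → let d′ , sim , q = l ℐ m (All.head mᴬ) in d′ , simulation m D p sim , q)) ,
       λ (_ , e) → ¬e (entails-weaken (concept (∃⟨ r ⟩ D) a) β∈ e)))

theorem41 : (𝒯₁ 𝒯₂ : TBox) → IsNormalisedTerminology 𝒯₁ → IsNormalisedTerminology 𝒯₂ →
    (Σ : Signature) (φ : ABox × InstanceAssertion) → φ ∈ iDiff Σ 𝒯₁ 𝒯₂ →
    (∃[ r ] ∃[ s ] ∃[ a ] ∃[ b ]
    (inj₂ r ∈ sig φ × inj₂ s ∈ sig φ ×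
    ([ role r a b ] , role s a b) ∈ iDiff Σ 𝒯₁ 𝒯₂))
    ⊎
    (∃[ 𝒜 ] ∃[ A ] ∃[ b ]
    (inj₁ A ∈ sig φ × sigABox 𝒜 ⊆ sig φ ×
    (𝒜 , concept (name A) b) ∈ iDiff Σ 𝒯₁ 𝒯₂))
    ⊎
    (∃[ 𝒜 ] ∃[ D ] ∃[ b ]
    (Singleton 𝒜 × b ∈ indABox 𝒜 × sigABox 𝒜 ⊆ sig φ × sigConcept D ⊆ sig φ ×
    (𝒜 , concept D b) ∈ iDiff Σ 𝒯₁ 𝒯₂))
theorem41 𝒯₁ 𝒯₂ nt₁ nt₂ Σ (𝒜 , concept C a) (sig𝒜⊆Σ , sigα⊆Σ , (ind , entails₁) , ¬entails₂) =
  Difference.reduce 𝒯₁ 𝒯₂ nt₁ nt₂ Σ 𝒜 (concept C a) [ sig𝒜⊆Σ , sigα⊆Σ ]′ C (ind refl) inj₂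
    (entails₁ canonical canonical-model canonical-modelᴬ) (λ e → ¬entails₂ (ind , e))
  where
  open Canonical 𝒯₁ 𝒜
  open Origins 𝒯₁ 𝒜 nt₁
theorem41 𝒯₁ 𝒯₂ nt₁ nt₂ Σ (𝒜 , role r a b) (sig𝒜⊆Σ , sigα⊆Σ , (ind , entails₁) , ¬entails₂)
  with All.lookup origin (entails₁ canonical canonical-model canonical-modelᴬ)
  where
  open Canonical 𝒯₁ 𝒜
  open Origins 𝒯₁ 𝒜 nt₁
-- No other origin fits an edge between two named individuals.
... | Origins.asserted o
  with Difference.role-difference 𝒯₁ 𝒯₂ nt₁ nt₂ Σ 𝒜 (role r a b) [ sig𝒜⊆Σ , sigα⊆Σ ]′
         (inj₂ refl) o
... | inj₁ difference = inj₁ difference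
... | inj₂ e          = ⊥-elim (¬entails₂ (ind , e))
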